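{- Let $\mathfrak{F}=\langle W,\{W_{\mathfrak{d}^{\alpha_i}_j}\},\{W_{\mathfrak{e}^{\alpha_i}}\},R_\Box,R_{\mathsf{A}},R_\blacksquare,R_{\mathsf{H}}\rangle$ be any $\mathsf{TLAE}$-frame. Then for every $w\in W$: $(w,w)\notin R_\blacksquare$, $(w,w)\notin R_\Box$, $(w,w)\notin R_{\mathsf{H}}$, and $(w,w)\notin R_{\mathsf{A}}$.
   Context: Fix finite sets $\mathtt{Action}=\{\delta_1,\dots,\delta_n\}$ (atomic action types) and $\mathtt{Agent}=\{\alpha_1,\dots,\alpha_m\}$ (agents). The set $\mathtt{Action}^*$ of action types is generated by $\Delta::=\delta_j\mid\Delta\cup\Delta\mid\overline{\Delta}$. For each agent $\alpha_i$ and each $j$ there is a propositional constant $\mathfrak{d}^{\alpha_i}_j$ and for each agent $\alpha_i$ a propositional constant $\mathfrak{e}^{\alpha_i}$. The translation $t$ is: $t(\delta_j^{\alpha_i})=\mathfrak{d}^{\alpha_i}_j$, $t(\overline{\Delta}^{\alpha_i})=\neg t(\Delta^{\alpha_i})$, $t(\Delta^{\alpha_i}\cup\Gamma^{\alpha_k})=t(\Delta^{\alpha_i})\vee t(\Gamma^{\alpha_k})$. An $\mathcal{L}$-frame is a tuple $\langle W,\{W_{\mathfrak{d}^{\alpha_i}_j}\}_{i,j},\{W_{\mathfrak{e}^{\alpha_i}}\}_{i},R_\Box,R_{\mathsf{A}},R_\blacksquare,R_{\mathsf{H}}\rangle$ where $W$ is a set of moments, each $W_{\mathfrak{d}^{\alpha_i}_j},W_{\mathfrak{e}^{\alpha_i}}\subseteq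 W$, and $R_\Box,R_{\mathsf{A}},R_\blacksquare,R_{\mathsf{H}}$ are binary relations on $W$. For action types define $W_{t(\delta_j^{\alpha_i})}=W_{\mathfrak{d}^{\alpha_i}_j}$, $W_{t(\overline{\Delta}^{\alpha_i})}=W\setminus W_{t(\Delta^{\alpha_i})}$, $W_{t(\Delta^{\alpha_i}\cup\Gamma^{\alpha_k})}=W_{t(\Delta^{\alpha_i})}\cup W_{t(\Gamma^{\alpha_k})}$. A $\mathsf{TLAE}$-frame is an $\mathcal{L}$-frame satisfying: (pA3) if $R_{\mathsf{A}}wu$ and $R_{\mathsf{A}}wv$ then $u=v$; (pA4) if $R_{\mathsf{A}}wu$ then $R_\Box wu$; (pA5) for every $w$, all pairwise distinct agents $\alpha_{1},\dots,\alpha_{k}$ and (not necessarily distinct) $\Delta_1,\dots,\Delta_k\in\mathtt{Action}^*$: if for each $i$ there is $u_i$ with $R_\Box wu_i$ and $u_i\in W_{t(\Delta_i^{\alpha_i})}$, then there is $v$ with $R_\Box wv$ and $v\in W_{t(\Delta_1^{\alpha_1})}\cap\dots\cap W_{t(\Delta_k^{\alpha_k})}$; (pA6) for every $w$ and agent $\alpha_i$: if some $v$ with $R_\Box wv$ lies in $W_{\mathfrak{e}^{\alpha_i}}$, then some $u$ with $R_\Box wu$ lies outside $W_{\mathfrak{e}^{\alpha_i}}$; (pA10;A11) $R_\Box wv$ iff $R_\blacksquare vw$; (pA12) if $R_\blacksquare wu$ and $R_\blacksquare wv$ then $u=v$; (pA9;A14) $R_{\mathsf{H}}$ is the transitive closure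 of $R_\blacksquare$; (pA13) for every $w$, either there is no $v$ with $R_{\mathsf{H}}wv$, or there is $u$ with $R_{\mathsf{H}}wu$ such that there is no $z$ with $R_{\mathsf{H}}uz$. -}

module Defs where

open import Level using (Level; _⊔_) renaming (suc to lsuc)
open import Data.Nat using (ℕ; suc)
open import Data.Fin using (Fin)
open import Data.Product using (∃-syntax; _×_)
open import Data.Sum using (_⊎_)
open import Function using (flip; Injective)
open import Relation.Nullary using (¬_)
open import Relation.Unary using (Pred; _∈_; _∉_; ∁; ⋂) renaming (_∪_ to _∪ₛ_)
open import Relation.Binary using (Rel; _⇒_; _⇔_)
open import Relation.Binary.Construct.Closure.Transitive using (TransClosure)
open import Relation.Binary.PropositionalEquality using (_≡_)

private
  variable
    m n : ℕ

-- Throughout, m is the number of agents and n the number of atomic action types.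

Agent : ℕ → Set
Agent m = Fin m

infixr 6 _∪_ _∪ᵃ_
infix  7 _^_
infixr 5 _∨′_

data ActionType (n : ℕ) : Set where
  δ        : Fin n → ActionType n
  _∪_      : ActionType n → ActionType n → ActionType n
  overline : ActionType n → ActionType n

-- Agent-bound action types; _∪ᵃ_ may join performances by different agents.
data AgentAction (m n : ℕ) : Set where
  _^_  : ActionType n → Agent m → AgentAction m n
  _∪ᵃ_ : AgentAction m n → AgentAction m n → AgentAction m n

-- The Boolean fragment of the language in which the translation t takes values.
data Formula (m n : ℕ) : Set where
  𝔡    : Agent m → Fin n → Formula m n
  𝔢    : Agent m → Formula m n
  ¬′_  : Formula m n → Formula m n
  _∨′_ : Formula m n → Formula m n → Formula m n

-- (Δ ∪ Γ) ^ α is read as (Δ ^ α) ∪ᵃ (Γ ^ α).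
t : AgentAction m n → Formula m n
t (δ j ^ α)        = 𝔡 α j
t ((Δ ∪ Γ) ^ α)    = t (Δ ^ α) ∨′ t (Γ ^ α)
t (overline Δ ^ α) = ¬′ t (Δ ^ α)
t (P ∪ᵃ Q)         = t P ∨′ t Q

record LFrame (m n : ℕ) (a ℓ : Level) : Set (lsuc (a ⊔ ℓ)) where
  field
    W  : Set a
    W𝔡 : Agent m → Fin n → Pred W ℓ
    W𝔢 : Agent m → Pred W ℓ
    R□ : Rel W ℓ
    RA : Rel W ℓ
    R■ : Rel W ℓ
    RH : Rel W ℓ

  W⟨_⟩ : Formula m n → Pred W ℓ
  W⟨ 𝔡 α j ⟩  = W𝔡 α j
  W⟨ 𝔢 α ⟩    = W𝔢 α
  W⟨ ¬′ φ ⟩   = ∁ W⟨ φ ⟩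
  W⟨ φ ∨′ ψ ⟩ = W⟨ φ ⟩ ∪ₛ W⟨ ψ ⟩

record IsTLAE {m n : ℕ} {a ℓ : Level} (𝔉 : LFrame m n a ℓ) : Set (a ⊔ ℓ) where
  open LFrame 𝔉
  field
    pA3 : ∀ {w u v} → RA w u → RA w v → u ≡ v
    pA4 : RA ⇒ R□
    -- The list of agents α₁,…,αₖ is non-empty: with k = 0 this condition
    -- would say that R□ is serial.
    pA5 : ∀ w {k} (α : Fin (suc k) → Agent m) (Δ : Fin (suc k) → ActionType n) →
          Injective _≡_ _≡_ α →
          (∀ i → ∃[ u ] R□ w u × u ∈ W⟨ t (Δ i ^ α i) ⟩) →
          ∃[ v ] R□ w v × v ∈ ⋂ (Fin (suc k)) (λ i → W⟨ t (Δ i ^ α i) ⟩)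
    pA6 : ∀ w α →
          (∃[ v ] R□ w v × v ∈ W⟨ 𝔢 α ⟩) →
          ∃[ u ] R□ w u × u ∉ W⟨ 𝔢 α ⟩
    pA10-A11 : R□ ⇔ flip R■
    pA12 : ∀ {w u v} → R■ w u → R■ w v → u ≡ v
    pA9-A14 : RH ⇔ TransClosure R■
    pA13 : ∀ w → ¬ (∃[ v ] RH w v) ⊎ (∃[ u ] RH w u × ¬ (∃[ z ] RH u z))

record TLAEFrame (m n : ℕ) (a ℓ : Level) : Set (lsuc (a ⊔ ℓ)) where
  field
    lFrame : LFrame m n a ℓ
    isTLAE : IsTLAE lFrame
  open LFrame lFrame public
  open IsTLAE isTLAE public

{-# OPTIONS --safe #-}
-- Since R■ is functional, every R■-successor of a moment on an R■-cycle is
-- again on a cycle. So if RH w w held, the terminal RH-successor of w provided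
-- by pA13 would lie on a cycle and not be terminal. The other three relations
-- are contained in RH or its converse.
module Submission where

open import Defs
open import Data.Nat using (ℕ)
open import Data.Product using (_×_; _,_; proj₁; proj₂)
open import Data.Sum using (inj₁; inj₂)
open import Function using (_∘_)
open import Level using (Level)
open import Relation.Binary using (Rel)
open import Relation.Binary.Construct.Closure.Transitive
  using (TransClosure; [_]; _∷_; _∷ʳ_)
open import Relation.Binary.PropositionalEquality using (_≡_; refl)
open import Relation.Binary.Rewriting using (Deterministic)
open import Relation.Nullary using (¬_)

module _ {a ℓ} {A : Set a} {R : Rel A ℓ} (det : Deterministic _≡_ R) where

  -- Determinism makes the given edge the first edge of the cycle, so moving it from the front to
  -- the back rotates the cycle to start at `y`. For a loop, `y` is `x` itself.
  cycle-step : ∀ {x y} → TransClosure R x x → R x y → TransClosure R y y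
  cycle-step [ xx ]      xy with refl ← det xx xy = [ xx ]
  cycle-step (xz ∷ z⁺x)  xy with refl ← det xz xy = z⁺x ∷ʳ xy

  cycle-reach : ∀ {x y} → TransClosure R x x → TransClosure R x y → TransClosure R y y
  cycle-reach x⁺x [ xy ]     = cycle-step x⁺x xy
  cycle-reach x⁺x (xz ∷ z⁺y) = cycle-reach (cycle-step x⁺x xz) z⁺y

mainTheorem1 : ∀ {m n : ℕ} {a ℓ : Level} (𝔉 : TLAEFrame m n a ℓ) →
    let open TLAEFrame 𝔉 in
    ∀ (w : W) → (¬ R■ w w) × (¬ R□ w w) × (¬ RH w w) × (¬ RA w w)
mainTheorem1 𝔉 w = ¬■ , ¬□ , ¬H , ¬□ ∘ pA4
  where
  open TLAEFrame 𝔉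

  ¬H : ¬ RH w w
  ¬H ww with pA13 w
  ... | inj₁ terminal            = terminal (w , ww)
  ... | inj₂ (u , wu , terminal) =
    -- The cycle carried along the path to `u` makes `u` its own `RH`-successor.
    terminal (u , proj₂ pA9-A14 (cycle-reach pA12 (proj₁ pA9-A14 ww) (proj₁ pA9-A14 wu)))

  ¬■ : ¬ R■ w w
  ¬■ ww = ¬H (proj₂ pA9-A14 [ ww ])

  ¬□ : ¬ R□ w w
  -- A loop is its own converse, so the swap of arguments is harmless.
  ¬□ = ¬■ ∘ proj₁ pA10-A11
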